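{- Suppose $Q$ is a directed set that is a countable union of $\omega_1$-directed sets. Then $\langle\mathcal U,\supseteq\rangle\not\leq_T Q$ for every nonprincipal ultrafilter $\mathcal U$ on $\omega$ satisfying $\operatorname{cf}(\operatorname{cf}(\langle\mathcal U,\supseteq\rangle))>\omega$.
   Context: A quasiorder is a set with a reflexive transitive relation $\leq$. A quasiorder is $\kappa$-directed if every subset of size less than $\kappa$ has an upper bound in it; directed means $\omega$-directed. "$Q$ is a countable union of $\omega_1$-directed sets" means $Q=\bigcup_{n<\omega}Q_n$ where each $Q_n\subseteq Q$, with the order inherited from $Q$, is $\omega_1$-directed. A subset $C$ of a quasiorder $P$ is cofinal if every $p\in P$ satisfies $p\leq c$ for some $c\in C$; $\operatorname{cf}(P)$ is the least cardinality of a cofinal subset of $P$. In $\operatorname{cf}(\operatorname{cf}(\langle\mathcal U,\supseteq\rangle))$ the outer $\operatorname{cf}$ is the cofinality of the cardinal $\operatorname{cf}(\langle\mathcal U,\supseteq\rangle)$. For directed sets $P,Q$, a map $f\colon P\to Q$ is Tukey if the $f$-image of every unbounded subset of $P$ is unbounded in $Q$; $P\leq_T Q$ means a Tukey map $P\to Q$ exists. $\langle\mathcal U,\supseteq\rangle$ denotes $\mathcal U$ ordered so that $A\leq B$ iff $A\supseteq B$. -}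

module Defs where

open import Axiom.ExcludedMiddle using (ExcludedMiddle)
open import Data.Fin.Base using (Fin)
open import Data.Nat.Base using (ℕ)
open import Data.Product.Base using (Σ; ∃; _×_; proj₁)
open import Data.Sum.Base using (_⊎_)
open import Function.Bundles using (Bijection; Func; Injection; _⇔_)
open import Induction.WellFounded using (WellFounded)
open import Level using (Level; Setω; 0ℓ; _⊔_; suc)
open import Relation.Binary.Bundles
  using (DecTotalOrder; Preorder; Setoid; StrictTotalOrder)
import Relation.Binary.Construct.On as On
import Relation.Binary.Properties.Preorder as PreorderProperties
import Relation.Binary.Properties.StrictTotalOrder as StrictTotalOrderProperties
import Relation.Binary.PropositionalEquality as ≡
open import Relation.Nullary.Negation.Core using (¬_)
open import Relation.Unary using (Pred; _∈_; _∉_; _⊆_; ∁; ∅; U; _∩_)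
open import Relation.Unary.Relation.Binary.Subset using (⊆-preorder)

private
  variable
    a b ℓ ℓ₁ ℓ₂ ℓ₃ ℓ₄ : Level

-- The ambient logic is classical.  As `Dec P` carries a witness of `P` whenever
-- `P` is inhabited, this also provides choice functions for families of types.
Classical : Setω
Classical = ∀ {ℓ} → ExcludedMiddle ℓ

-- Sets are setoids and quasiorders are preorders over a setoid.  Under
-- `Classical` a predicate of any level is pointwise equivalent to one of level
-- 0ℓ, so fixing this level loses no subsets.  Subsets need not respect the
-- setoid equality: closing one under it changes neither its cardinality, nor
-- its upper bounds, nor whether it is cofinal.
Subset : Set a → Set (a ⊔ suc 0ℓ)
Subset A = Pred A 0ℓ

module _ (S : Setoid a ℓ) where
  open Setoid S

  subsetoid : Pred Carrier ℓ₁ → Setoid (a ⊔ ℓ₁) ℓ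
  subsetoid A = On.setoid S (proj₁ {B = A})

------------------------------------------------------------------------
-- Cardinalities

_≤ᶜ_ : Setoid a ℓ₁ → Setoid b ℓ₂ → Set _
X ≤ᶜ Y = Injection X Y

_≈ᶜ_ : Setoid a ℓ₁ → Setoid b ℓ₂ → Set _
X ≈ᶜ Y = Bijection X Y

_<ᶜ_ : Setoid a ℓ₁ → Setoid b ℓ₂ → Set _
X <ᶜ Y = (X ≤ᶜ Y) × ¬ (Y ≤ᶜ X)

ω : Setoid 0ℓ 0ℓ
ω = ≡.setoid ℕ

Finite : Setoid a ℓ → Set _
Finite X = ∃ λ n → X ≤ᶜ ≡.setoid (Fin n)

Countable : Setoid a ℓ → Set _
Countable X = X ≤ᶜ ω

-- Cardinals as initial ordinals: well-orders that do not inject into any of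
-- their proper initial segments.
record Cardinal a ℓ₁ ℓ₂ : Set (suc (a ⊔ ℓ₁ ⊔ ℓ₂)) where
  field
    strictTotalOrder : StrictTotalOrder a ℓ₁ ℓ₂

  open StrictTotalOrder strictTotalOrder using (Carrier; _<_; module Eq)

  setoid : Setoid a ℓ₁
  setoid = Eq.setoid

  field
    wellFounded : WellFounded _<_
    initial     : ∀ x → ¬ (setoid ≤ᶜ subsetoid setoid (_< x))

  ordering : Preorder a ℓ₁ (ℓ₁ ⊔ ℓ₂)
  ordering = DecTotalOrder.preorder
    (StrictTotalOrderProperties.decTotalOrder strictTotalOrder)

------------------------------------------------------------------------
-- Quasiorders

module _ (P : Preorder a ℓ₁ ℓ₂) where
  open Preorder P

  restrict : Subset Carrier → Preorder a ℓ₁ ℓ₂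
  restrict A = On.preorder P (proj₁ {B = A})

  Bounded : Pred Carrier ℓ → Set _
  Bounded A = ∃ λ u → ∀ x → x ∈ A → x ≲ u

  -- Every subset of size less than ω has an upper bound.
  Directed : Set _
  Directed = (A : Subset Carrier) → Finite (subsetoid Eq.setoid A) → Bounded A

  -- Every subset of size less than ω₁, that is, at most ω, has an upper bound.
  ω₁-Directed : Set _
  ω₁-Directed = (A : Subset Carrier) → Countable (subsetoid Eq.setoid A) → Bounded A

  Cofinal : Subset Carrier → Set _
  Cofinal C = ∀ p → ∃ λ c → c ∈ C × p ≲ c

  IsCofinality : Cardinal b ℓ₃ ℓ₄ → Set _
  IsCofinality κ =
    (∃ λ C → Cofinal C × (subsetoid Eq.setoid C ≈ᶜ Cardinal.setoid κ)) ×
    (∀ C → Cofinal C → Cardinal.setoid κ ≤ᶜ subsetoid Eq.setoid C)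

IsCountableUnionOfω₁-Directed : Preorder a ℓ₁ ℓ₂ → Set _
IsCountableUnionOfω₁-Directed P = Σ (ℕ → Subset Carrier) λ Q →
  (∀ n → ω₁-Directed (restrict P (Q n))) ×
  (∀ x → ∃ λ n → x ∈ Q n)
  where open Preorder P using (Carrier)

module _ (P : Preorder a ℓ₁ ℓ₂) (Q : Preorder b ℓ₃ ℓ₄) where
  private
    module P = Preorder P
    module Q = Preorder Q

  image : Func P.Eq.setoid Q.Eq.setoid → Pred P.Carrier ℓ → Pred Q.Carrier _
  image f A y = ∃ λ x → x ∈ A × (Func.to f x Q.≈ y)

  Tukey : Func P.Eq.setoid Q.Eq.setoid → Set _
  Tukey f = (A : Subset P.Carrier) → ¬ Bounded P A → ¬ Bounded Q (image f A)

  _≤ᵀ_ : Set _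
  _≤ᵀ_ = ∃ Tukey

------------------------------------------------------------------------
-- Ultrafilters on ω

record IsUltrafilter (𝓤 : Subset (Subset ℕ)) : Set (suc 0ℓ) where
  field
    full         : U ∈ 𝓤
    proper       : ∅ ∉ 𝓤
    upward       : ∀ {A B} → A ⊆ B → A ∈ 𝓤 → B ∈ 𝓤
    intersection : ∀ {A B} → A ∈ 𝓤 → B ∈ 𝓤 → A ∩ B ∈ 𝓤
    ultra        : ∀ A → A ∈ 𝓤 ⊎ ∁ A ∈ 𝓤

Principal : Subset (Subset ℕ) → Set (suc 0ℓ)
Principal 𝓤 = ∃ λ n → ∀ A → A ∈ 𝓤 ⇔ n ∈ A

-- The setoid equality on the members of 𝓤 is extensional equality `_≐_`.
⟨_,⊇⟩ : Subset (Subset ℕ) → Preorder (suc 0ℓ) 0ℓ 0ℓ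
⟨ 𝓤 ,⊇⟩ = On.preorder
  (PreorderProperties.converse-preorder (⊆-preorder ℕ 0ℓ))
  (proj₁ {B = 𝓤})

{-# OPTIONS --safe #-}

-- Let f : ⟨ 𝓤 ,⊇⟩ → Q be Tukey and Q = ⋃ Qₙ with every Qₙ ω₁-directed.  The
-- intersection of f⁻¹(Qₙ) is already the intersection of countably many of its
-- members, one omitting k for each omitted k ∈ ω.  Their images have an upper
-- bound in Qₙ, so f⁻¹(Qₙ) has an upper bound yₙ in 𝓤.  Hence the yₙ form a
-- countable cofinal subset, so that κ, and with it μ, is countable.
module Submission where

open import Data.Nat.Base using (ℕ; _<_)
open import Data.Nat.Induction using (<-rec)
open import Data.Nat.Properties using (<-cmp)
open import Data.Product.Base using (∃; _×_; _,_; proj₁; proj₂)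
open import Data.Unit.Base using (tt)
open import Function.Base using (_∘_)
open import Function.Bundles using (Func)
open import Function.Construct.Composition using (injection)
open import Level using (Level)
open import Relation.Binary.Bundles using (Preorder; Setoid)
open import Relation.Binary.Definitions using (tri<; tri≈; tri>)
open import Relation.Binary.PropositionalEquality.Core using (_≡_; subst)
import Relation.Binary.PropositionalEquality.Core as ≡
open import Relation.Nullary.Decidable
  using (yes; no; True; toWitness; fromWitness; decidable-stable)
open import Relation.Nullary.Negation.Core using (¬_; contradiction)
open import Relation.Unary using (Pred; _∈_; _∉_; U)
open import Defs

private
  variable
    a b ℓ ℓ₁ ℓ₂ ℓ₃ ℓ₄ : Level

subsetoid-≤ᶜ : (S : Setoid a ℓ₁) (A : Pred (Setoid.Carrier S) ℓ) →
               subsetoid S A ≤ᶜ S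
subsetoid-≤ᶜ S A = record
  { to        = proj₁
  ; cong      = λ x≈y → x≈y
  ; injective = λ x≈y → x≈y
  }

IsLeast : Pred ℕ ℓ → Pred ℕ ℓ
IsLeast P n = P n × (∀ {m} → m < n → m ∉ P)

-- Two equivalent predicates are allowed because setoid-equal `x` and `y` yield the distinct
-- conditions `s n ≈ x` and `s n ≈ y`.
IsLeast-unique : {P : Pred ℕ ℓ₁} {Q : Pred ℕ ℓ₂} →
                 (∀ {n} → P n → Q n) → (∀ {n} → Q n → P n) →
                 ∀ {m n} → IsLeast P m → IsLeast Q n → m ≡ n
IsLeast-unique P⊆Q Q⊆P {m} {n} (Pm , m-min) (Qn , n-min) with <-cmp m n
... | tri< m<n _ _ = contradiction (P⊆Q Pm) (n-min m<n)
... | tri≈ _ m≡n _ = m≡n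
... | tri> _ _ n<m = contradiction (Q⊆P Qn) (m-min n<m)

module _ (em : Classical) where

  least : {P : Pred ℕ ℓ} → ∃ P → ∃ (IsLeast P)
  least {P = P} (n , Pn) = <-rec (λ n → P n → ∃ (IsLeast P)) step n Pn
    where
    step : ∀ n → (∀ {m} → m < n → P m → ∃ (IsLeast P)) → P n → ∃ (IsLeast P)
    step n rec Pn with em {P = ∃ λ m → m < n × P m}
    ... | yes (m , m<n , Pm) = rec m<n Pm
    ... | no  none           = n , Pn , λ m<n Pm → none (_ , m<n , Pm)

  module _ (S : Setoid a ℓ) (s : ℕ → Setoid.Carrier S) where
    open Setoid S using (Carrier; _≈_; sym; trans) renaming (refl to ≈-refl)

    -- `True` moves the predicate to level 0ℓ.
    range : Subset Carrier
    range x = True (em {P = ∃ λ n → s n ≈ x})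

    ∈-range : ∀ n → s n ∈ range
    ∈-range n = fromWitness (n , ≈-refl)

    -- Each element goes to the least index at which `s` attains it. Leastness makes this choice
    -- respect `_≈_`, and the value of `s` there recovers the element.
    range-countable : Countable (subsetoid S range)
    range-countable = record
      { to        = λ x → proj₁ (index x)
      ; cong      = λ {x} {y} x≈y → IsLeast-unique
          (λ e → trans e x≈y) (λ e → trans e (sym x≈y))
          (proj₂ (index x)) (proj₂ (index y))
      ; injective = λ {x} {y} i≡j → trans
          (sym (proj₁ (proj₂ (index x))))
          (subst (λ n → s n ≈ proj₁ y) (≡.sym i≡j) (proj₁ (proj₂ (index y))))
      }
      where
      index : (x : ∃ range) → ∃ (IsLeast λ n → s n ≈ proj₁ x)
      index (x , x∈range) = least (toWitness x∈range)

  -- Contrapositive of the Tukey property: the image of the range of `s` is, up to equality, a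
  -- countable subset of `D`, hence bounded, so the range cannot be unbounded.
  tukey-bounds-sequence :
    (P : Preorder a ℓ₁ ℓ₂) (Q : Preorder b ℓ₃ ℓ₄)
    (f : Func (Preorder.Eq.setoid P) (Preorder.Eq.setoid Q)) → Tukey P Q f →
    (D : Subset (Preorder.Carrier Q)) → ω₁-Directed (restrict Q D) →
    (s : ℕ → Preorder.Carrier P) → (∀ n → Func.to f (s n) ∈ D) →
    ∃ λ u → ∀ n → Preorder._≲_ P (s n) u
  tukey-bounds-sequence P Q f tukey D directed s fs∈D =
    let u , s≲u = decidable-stable em λ unbounded → tukey S unbounded fS-bounded
    in  u , λ n → s≲u (s n) (∈-range P.Eq.setoid s n)
    where
    module P = Preorder P
    module Q = Preorder Q
    D-order = restrict Q D
    D-setoid = Preorder.Eq.setoid D-order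

    S : Subset P.Carrier
    S = range P.Eq.setoid s

    fs : ℕ → Preorder.Carrier D-order
    fs n = Func.to f (s n) , fs∈D n

    fS-bounded : Bounded Q (image P Q f S)
    fS-bounded =
      -- Directedness concerns the order restricted to `D`, so the range is taken there, of values
      -- paired with their membership proofs.
      let (v , _) , fs≲v = directed (range D-setoid fs)
                                    (range-countable D-setoid fs)
      in  v , λ y (x , x∈S , fx≈y) →
            let n , sn≈x = toWitness x∈S
            in  Q.≲-respˡ-≈ (Q.Eq.trans (Func.cong f sn≈x) fx≈y)
                            (fs≲v (fs n) (∈-range D-setoid fs n))

  module _ (𝓤 : Subset (Subset ℕ)) (full : U ∈ 𝓤) where
    private module 𝓤 = Preorder ⟨ 𝓤 ,⊇⟩

    -- A bound is a member of `𝓤` contained in every `x ∈ A`. Since `ω` is countable, one sequence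
    -- in `A` can witness every point that some member of `A` omits.
    sequence-bounds⇒bounded :
      (A : Pred 𝓤.Carrier ℓ) →
      ((s : ℕ → 𝓤.Carrier) → (∀ n → s n ∈ A) → ∃ λ u → ∀ n → s n 𝓤.≲ u) →
      Bounded ⟨ 𝓤 ,⊇⟩ A
    sequence-bounds⇒bounded A bound with em {P = ∃ A}
    -- With `A` empty there is no sequence to bound; any member of `𝓤` serves, and `U` is at hand.
    ... | no empty = (U , full) , λ x x∈A → contradiction (x , x∈A) empty
    ... | yes (x₀ , x₀∈A) =
      let u , s≲u = bound (proj₁ ∘ omit) (proj₁ ∘ proj₂ ∘ omit)
      -- If `k ∈ u` but `k ∉ x`, then the `k`-th term of the sequence omits `k` too, although it
      -- contains `u`.
      in  u , λ x x∈A {k} k∈u →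
            decidable-stable em λ k∉x →
              proj₂ (proj₂ (omit k)) (x , x∈A , k∉x) (s≲u k k∈u)
      where
      Omitting : ℕ → Set _
      Omitting k = ∃ λ x → x ∈ A × k ∉ proj₁ x

      omit : ∀ k → ∃ λ x → x ∈ A × (Omitting k → k ∉ proj₁ x)
      omit k with em {P = Omitting k}
      ... | yes (x , x∈A , k∉x) = x , x∈A , λ _ → k∉x
      -- Here `x₀` is only a default that keeps the sequence inside `A`.
      ... | no  none            = x₀ , x₀∈A , λ o → contradiction o none

    countably-cofinal :
      (Q : Preorder b ℓ₃ ℓ₄) → IsCountableUnionOfω₁-Directed Q →
      ⟨ 𝓤 ,⊇⟩ ≤ᵀ Q →
      ∃ λ C → Cofinal ⟨ 𝓤 ,⊇⟩ C × Countable (subsetoid 𝓤.Eq.setoid C)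
    countably-cofinal Q (D , D-directed , D-covers) (f , tukey) =
      range 𝓤.Eq.setoid y , cofinal , range-countable 𝓤.Eq.setoid y
      where
      preimage-bounded : ∀ n → Bounded ⟨ 𝓤 ,⊇⟩ (λ x → Func.to f x ∈ D n)
      preimage-bounded n = sequence-bounds⇒bounded _
        (tukey-bounds-sequence ⟨ 𝓤 ,⊇⟩ Q f tukey (D n) (D-directed n))

      y : ℕ → 𝓤.Carrier
      y n = proj₁ (preimage-bounded n)

      cofinal : Cofinal ⟨ 𝓤 ,⊇⟩ (range 𝓤.Eq.setoid y)
      cofinal x =
        let n , fx∈D = D-covers (Func.to f x)
        in  y n , ∈-range 𝓤.Eq.setoid y n , proj₂ (preimage-bounded n) x fx∈D

-- By reflexivity the whole of `P` is cofinal, so minimality of `κ` applies to `U`.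
cofinality-≤ᶜ : (P : Preorder a ℓ₁ ℓ₂) (κ : Cardinal b ℓ₃ ℓ₄) →
                IsCofinality P κ → Cardinal.setoid κ ≤ᶜ Preorder.Eq.setoid P
cofinality-≤ᶜ P κ (_ , minimal) = injection
  (minimal U λ p → p , tt , Preorder.refl P)
  (subsetoid-≤ᶜ (Preorder.Eq.setoid P) _)

theorem3p16 : Classical →
    ∀ {c ℓ₁ ℓ₂} (Q : Preorder c ℓ₁ ℓ₂) →
    Directed Q →
    IsCountableUnionOfω₁-Directed Q →
    (𝓤 : Subset (Subset ℕ)) →
    IsUltrafilter 𝓤 →
    ¬ Principal 𝓤 →
    ∀ {k k₁ k₂ m m₁ m₂} (κ : Cardinal k k₁ k₂) (μ : Cardinal m m₁ m₂) →
    IsCofinality ⟨ 𝓤 ,⊇⟩ κ →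
    IsCofinality (Cardinal.ordering κ) μ →
    ω <ᶜ Cardinal.setoid μ →
    ¬ (⟨ 𝓤 ,⊇⟩ ≤ᵀ Q)
theorem3p16 em Q _ union 𝓤 ultrafilter _ κ μ κ-cof μ-cof (_ , μ≰ω) 𝓤≤Q =
  let C , C-cofinal , C≤ω =
        countably-cofinal em 𝓤 (IsUltrafilter.full ultrafilter) Q union 𝓤≤Q
      κ≤C = proj₂ κ-cof C C-cofinal
      -- `Cardinal.ordering κ` has the same underlying setoid as `κ`, so this composes with `κ≤C`
      -- and `C≤ω`.
      μ≤κ = cofinality-≤ᶜ (Cardinal.ordering κ) μ μ-cof
  in  μ≰ω (injection μ≤κ (injection κ≤C C≤ω))
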